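{- There is a positive constant $\gamma$ such that for every integer $t \geq 30$ and every integer $m \leq \gamma 2^t$, every $(m,m,m,m)$-cube $A$ of order $n=2^t$ is avoidable.
   Context: A cube of order $n$ is an $n\times n\times n$ array of cells $(i,j,k)$, $i,j,k\in[n]=\{1,\dots,n\}$. A line of a cube is obtained by fixing two coordinates and letting the third vary: a row is $\{(i,j^*,k): j^*\in[n]\}$, a column is $\{(i^*,j,k): i^*\in[n]\}$, a file is $\{(i,j,k^*):k^*\in[n]\}$. An $(m,m,m,m)$-cube of order $n$ is a cube $A$ of order $n$ in which each cell $(i,j,k)$ contains a subset $A(i,j,k)\subseteq[n]$ such that: every cell contains at most $m$ symbols, and each symbol occurs at most $m$ times in each row, at most $m$ times in each column, and at most $m$ times in each file. A Latin cube $L$ of order $n$ is a cube of order $n$ whose every cell contains one symbol $L(i,j,k)\in[n]$ such that each symbol appears exactly once in each row, column and file. $A$ is avoidable if there is a Latin cube $L$ of order $n$ with $L(i,j,k)\notin A(i,j,k)$ for all $i,j,k\in[n]$. -}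

module Defs where

open import Data.Nat.Base using (ℕ; _≤_)
open import Data.Fin.Base using (Fin)
open import Data.Fin.Subset using (Subset; ∣_∣; _∉_)
open import Data.Fin.Subset.Properties using (_∈?_)
open import Data.Product using (∃-syntax; ∃!; _×_)
open import Data.Vec.Base using (Vec; tabulate; count)
open import Relation.Binary.PropositionalEquality using (_≡_)

-- [n] = {1,…,n} is represented by Fin n.

Cube : Set → ℕ → Set
Cube X n = (i j k : Fin n) → X

module _ {X : Set} {n : ℕ} (A : Cube X n) where

  row : (i k : Fin n) → Vec X n
  row i k = tabulate λ j → A i j k

  column : (j k : Fin n) → Vec X n
  column j k = tabulate λ i → A i j k

  file : (i j : Fin n) → Vec X n
  file i j = tabulate λ k → A i j k

occurrences : ∀ {n l} → Fin n → Vec (Subset n) l → ℕ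
occurrences s = count (s ∈?_)

-- A is an (m,m,m,m)-cube of order n.
record IsMCube (m : ℕ) {n : ℕ} (A : Cube (Subset n) n) : Set where
  field
    cell-≤   : ∀ i j k → ∣ A i j k ∣ ≤ m
    row-≤    : ∀ s i k → occurrences s (row A i k) ≤ m
    column-≤ : ∀ s j k → occurrences s (column A j k) ≤ m
    file-≤   : ∀ s i j → occurrences s (file A i j) ≤ m

record IsLatinCube {n : ℕ} (L : Cube (Fin n) n) : Set where
  field
    row-once    : ∀ s i k → ∃! _≡_ λ j → L i j k ≡ s
    column-once : ∀ s j k → ∃! _≡_ λ i → L i j k ≡ s
    file-once   : ∀ s i j → ∃! _≡_ λ k → L i j k ≡ s

Avoidable : ∀ {n} → Cube (Subset n) n → Set
Avoidable {n} A =
  ∃[ L ] IsLatinCube {n} L × (∀ i j k → L i j k ∉ A i j k)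

{-# OPTIONS --safe #-}

-- View A as a 4-ary relation on [n] with at most m points on every axis-parallel line. If each coordinate of
-- order n = N c is partitioned into N blocks of size c, then a Latin cube of order N, inflated by an arbitrary
-- Latin cube of order c in each block, is a Latin cube of order n; so it suffices to treat the blocks separately.
-- A random partition splits every line evenly: for N = 4, m drops to m / 4 + O(√m log n). Repeating this, the
-- density m / n stays bounded while n goes down to the constant 2^200, where m is only of order log² n. There,
-- random partitions with N = 2^189 leave at most 6^4 conflicts in each block of order c = 2^11, fewer than
-- there are translates of the Boolean Latin cube of order c, and these are pairwise disjoint. Randomness is
-- replaced by the method of conditional expectations.
module Submission where

open import Data.Bool.Base using (Bool; true; false)
open import Data.Fin.Base using (Fin; zero; suc; combine; remQuot; _↑ˡ_; _↑ʳ_)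
open import Data.Fin.Patterns using (0F; 1F)
open import Data.Fin.Properties using (remQuot-combine; combine-remQuot)
open import Data.Fin.Subset using (Subset; ∣_∣)
open import Data.Fin.Subset.Properties using (_∈?_)
import Data.Integer.Base as ℤ
import Data.Integer.Properties as ℤ
open import Data.Nat.Base using (ℕ; zero; suc; _+_; _*_; _∸_; _^_; _≤_; _≥_; _<_; z≤n; s≤s; NonZero; >-nonZero)
open import Data.Nat.Properties
open import Algebra.Properties.Semiring.Sum +-*-semiring using (sum; sum-cong-≗; ∑-distrib-+; ∑-comm; *-distribˡ-sum; *-distribʳ-sum; sum-permute)
open import Data.Nat.Tactic.RingSolver using (solve-∀)
open import Data.Product using (Σ-syntax; ∃-syntax; ∃!; _×_; _,_; proj₁; proj₂; uncurry)
open import Data.Product.Properties using (,-injective)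
open import Data.Rational.Base as ℚ using (ℚ; 0ℚ)
import Data.Rational.Properties as ℚ
open import Data.Rational.Unnormalised.Base as ℚᵘ using (mkℚᵘ)
import Data.Rational.Unnormalised.Properties as ℚᵘ
open import Data.Sum.Base using (_⊎_; inj₁; inj₂)
open import Data.Unit.Base using (tt)
open import Data.Vec.Base using ([]; _∷_; lookup; tabulate)
open import Data.Vec.Properties using ([]=⇒lookup)
open import Function.Base using (_∘_)
open import Function.Bundles using (Inverse; _↔_; mk↔ₛ′)
open import Function.Construct.Composition using (_↔-∘_)
open import Relation.Binary.PropositionalEquality using (_≡_; refl; sym; trans; cong; cong₂; subst; subst₂)
open import Relation.Nullary using (does; yes; no; contradiction)
open import Defs

-- Finite sums and products

prod : ∀ {n} → (Fin n → ℕ) → ℕ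
prod {zero}  f = 1
prod {suc n} f = f zero * prod (f ∘ suc)

𝟙 : Bool → ℕ
𝟙 true  = 1
𝟙 false = 0

count : ∀ {n} → (Fin n → Bool) → ℕ
count f = sum (𝟙 ∘ f)

sum-mono : ∀ {n} {f g : Fin n → ℕ} → (∀ x → f x ≤ g x) → sum f ≤ sum g
sum-mono {zero}  f≤g = z≤n
sum-mono {suc n} f≤g = +-mono-≤ (f≤g zero) (sum-mono (f≤g ∘ suc))

term≤sum : ∀ {n} (f : Fin n → ℕ) x → f x ≤ sum f
term≤sum f zero    = m≤m+n _ _
term≤sum f (suc x) = ≤-trans (term≤sum (f ∘ suc) x) (m≤n+m _ _)

sum-const : ∀ n x → sum {n} (λ _ → x) ≡ n * x
sum-const zero    x = refl
sum-const (suc n) x = cong (x +_) (sum-const n x)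

sum≤* : ∀ {n} {f : Fin n → ℕ} b → (∀ x → f x ≤ b) → sum f ≤ n * b
sum≤* {n} b f≤b = ≤-trans (sum-mono f≤b) (≤-reflexive (sum-const n b))

prod-cong : ∀ {n} {f g : Fin n → ℕ} → (∀ x → f x ≡ g x) → prod f ≡ prod g
prod-cong {zero}  f≡g = refl
prod-cong {suc n} f≡g = cong₂ _*_ (f≡g zero) (prod-cong (f≡g ∘ suc))

sum-++ : ∀ m {n} (f : Fin (m + n) → ℕ) →
  sum f ≡ sum (λ i → f (i ↑ˡ n)) + sum (λ j → f (m ↑ʳ j))
sum-++ zero    f = refl
sum-++ (suc m) f = trans (cong (f zero +_) (sum-++ m (f ∘ suc))) (sym (+-assoc (f zero) _ _))

sum-combine : ∀ m {n} (f : Fin (m * n) → ℕ) → sum f ≡ sum (λ i → sum (λ j → f (combine {m} {n} i j)))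
sum-combine zero        f = refl
sum-combine (suc m) {n} f = trans (sum-++ n f) (cong (sum (λ j → f (j ↑ˡ m * n)) +_) (sum-combine m (f ∘ (n ↑ʳ_))))

averaging : ∀ n .{{_ : NonZero n}} (f : Fin n → ℕ) → Σ[ v ∈ Fin n ] n * f v ≤ sum f
averaging (suc zero)      f = zero , ≤-refl
averaging (suc n@(suc _)) f with averaging n (f ∘ suc)
... | v , ih with ≤-total (f zero) (f (suc v))
...   | inj₁ f0≤ = zero , +-monoʳ-≤ (f zero) (≤-trans (*-monoʳ-≤ n f0≤) ih)
...   | inj₂ ≤f0 = suc v , +-mono-≤ ≤f0 ih

-- The method of conditional expectations: σ does at least as well as a uniformly random function.
derandomise : ∀ {Q} c {N} .{{_ : NonZero N}} (w : Fin Q → ℕ) (g : Fin Q → Fin c → Fin N → ℕ) →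
  Σ[ σ ∈ (Fin c → Fin N) ]
    N ^ c * sum (λ κ → w κ * prod (λ a → g κ a (σ a))) ≤ sum (λ κ → w κ * prod (λ a → sum (g κ a)))
derandomise zero w g = (λ ()) , ≤-reflexive (*-identityˡ _)
derandomise {Q} (suc c) {N} w g = σ , (begin
  N * N ^ c * sum (λ κ → w κ * (g κ zero v * prod (λ a → g κ (suc a) (σ′ a))))
    ≡⟨ *-assoc N _ _ ⟩
  N * (N ^ c * sum (λ κ → w κ * (g κ zero v * prod (λ a → g κ (suc a) (σ′ a)))))
    ≡⟨ cong (λ s → N * (N ^ c * s)) (sum-cong-≗ λ κ → sym (*-assoc (w κ) _ _)) ⟩
  N * (N ^ c * sum (λ κ → w κ * g κ zero v * prod (λ a → g κ (suc a) (σ′ a))))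
    ≤⟨ *-monoʳ-≤ N (proj₂ ih) ⟩
  N * h v
    ≤⟨ proj₂ avg ⟩
  sum h
    ≡⟨ ∑-comm (λ v κ → w κ * g κ zero v * R κ) ⟩
  sum (λ κ → sum (λ v → w κ * g κ zero v * R κ))
    ≡⟨ sum-cong-≗ (λ κ → sym (collect κ)) ⟩
  sum (λ κ → w κ * (sum (g κ zero) * R κ)) ∎)
  where
  open ≤-Reasoning
  R : Fin Q → ℕ
  R κ = prod (λ a → sum (g κ (suc a)))
  h : Fin N → ℕ
  h v = sum (λ κ → w κ * g κ zero v * R κ)
  avg = averaging N h
  v = proj₁ avg
  -- The factor fixed by `v` joins the weight; this is why the statement carries `w`.
  ih = derandomise c (λ κ → w κ * g κ zero v) (λ κ → g κ ∘ suc)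
  σ′ = proj₁ ih
  σ : Fin (suc c) → Fin N
  σ zero    = v
  σ (suc a) = σ′ a
  collect : ∀ κ → w κ * (sum (g κ zero) * R κ) ≡ sum (λ v → w κ * g κ zero v * R κ)
  collect κ = trans (sym (*-assoc (w κ) _ _))
    (trans (cong (_* R κ) (*-distribˡ-sum (w κ) (g κ zero))) (*-distribʳ-sum (R κ) (λ v → w κ * g κ zero v)))

-- Moment estimates with denominators cleared

^-distribʳ-* : ∀ n a b → (a * b) ^ n ≡ a ^ n * b ^ n
^-distribʳ-* zero    a b = refl
^-distribʳ-* (suc n) a b = trans (cong (a * b *_) (^-distribʳ-* n a b)) ([m*n]*[o*p]≡[m*o]*[n*p] a b _ _)

-- Bernoulli's inequality 1 + s q/x ≤ (1 + q/x)^s, multiplied out to stay in ℕ. The induction step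
-- drops the term in q² s.
bernoulli : ∀ x q s → x ^ s * (x + q * s) ≤ x * (x + q) ^ s
bernoulli x q zero = ≤-reflexive (lem x q)
  where
  lem : ∀ x q → 1 * (x + q * 0) ≡ x * 1
  lem = solve-∀
bernoulli x q (suc s) = begin
  x * x ^ s * (x + q * suc s)         ≤⟨ m≤m+n _ _ ⟩
  x * x ^ s * (x + q * suc s) + x ^ s * (q * (q * s))
                                      ≡⟨ lem₁ x (x ^ s) q s ⟩
  x ^ s * (x + q * s) * (x + q)       ≤⟨ *-monoˡ-≤ (x + q) (bernoulli x q s) ⟩
  x * (x + q) ^ s * (x + q)           ≡⟨ lem₂ x (x + q) ((x + q) ^ s) ⟩
  x * ((x + q) * (x + q) ^ s)         ∎
  where
  open ≤-Reasoning
  lem₁ : ∀ x y q s → x * y * (x + q * (1 + s)) + y * (q * (q * s)) ≡ y * (x + q * s) * (x + q)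
  lem₁ = solve-∀
  lem₂ : ∀ x y z → x * z * y ≡ x * (y * z)
  lem₂ = solve-∀

prod-bernoulli : ∀ {c} x q (s : Fin c → ℕ) →
  x ^ sum s * prod (λ a → x + q * s a) ≤ x ^ c * (x + q) ^ sum s
prod-bernoulli {zero}  x q s = ≤-refl
prod-bernoulli {suc c} x q s = begin
  x ^ (s₀ + ∑s) * ((x + q * s₀) * P)          ≡⟨ cong (_* ((x + q * s₀) * P)) (^-distribˡ-+-* x s₀ ∑s) ⟩
  x ^ s₀ * x ^ ∑s * ((x + q * s₀) * P)        ≡⟨ [m*n]*[o*p]≡[m*o]*[n*p] (x ^ s₀) (x ^ ∑s) _ P ⟩
  x ^ s₀ * (x + q * s₀) * (x ^ ∑s * P)        ≤⟨ *-mono-≤ (bernoulli x q s₀) (prod-bernoulli x q (s ∘ suc)) ⟩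
  x * (x + q) ^ s₀ * (x ^ c * (x + q) ^ ∑s)   ≡⟨ [m*n]*[o*p]≡[m*o]*[n*p] x _ (x ^ c) _ ⟩
  x * x ^ c * ((x + q) ^ s₀ * (x + q) ^ ∑s)   ≡⟨ cong (x * x ^ c *_) (^-distribˡ-+-* (x + q) s₀ ∑s) ⟨
  x * x ^ c * (x + q) ^ (s₀ + ∑s)             ∎
  where
  open ≤-Reasoning
  s₀ = s zero
  ∑s = sum (s ∘ suc)
  P = prod (λ a → x + q * s (suc a))

-- This bounds the moment generating function of the number of hits: ∏ (1 + q s_a / x) ≤ (1 +
-- q/x)^M, however the total is spread over the classes `a`.
prod-bound : ∀ {c} x q M (s : Fin c → ℕ) → sum s ≤ M →
  x ^ M * prod (λ a → x + q * s a) ≤ x ^ c * (x + q) ^ M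
prod-bound {c} x q M s ∑s≤M = begin
  x ^ M * P                              ≡⟨ cong (λ M → x ^ M * P) (sym (m+[n∸m]≡n ∑s≤M)) ⟩
  x ^ (sum s + d) * P                    ≡⟨ cong (_* P) (^-distribˡ-+-* x (sum s) d) ⟩
  x ^ sum s * x ^ d * P                  ≡⟨ lem (x ^ sum s) (x ^ d) P ⟩
  x ^ sum s * P * x ^ d                  ≤⟨ *-mono-≤ (prod-bernoulli x q s) (^-monoˡ-≤ d (m≤m+n x q)) ⟩
  x ^ c * (x + q) ^ sum s * (x + q) ^ d  ≡⟨ *-assoc (x ^ c) _ _ ⟩
  x ^ c * ((x + q) ^ sum s * (x + q) ^ d) ≡⟨ cong (x ^ c *_) (^-distribˡ-+-* (x + q) (sum s) d) ⟨
  x ^ c * (x + q) ^ (sum s + d)          ≡⟨ cong (λ M → x ^ c * (x + q) ^ M) (m+[n∸m]≡n ∑s≤M) ⟩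
  x ^ c * (x + q) ^ M                    ∎
  where
  open ≤-Reasoning
  d = M ∸ sum s
  P = prod (λ a → x + q * s a)
  lem : ∀ a b c → a * b * c ≡ a * c * b
  lem = solve-∀

-- The product is p^c (1 + q/p)^count, the exponential weight of the count, here without division.
prod-indicator : ∀ {c} p q (b : Fin c → Bool) →
  prod (λ a → p + q * 𝟙 (b a)) * p ^ count b ≡ (p + q) ^ count b * p ^ c
prod-indicator {zero}  p q b = refl
prod-indicator {suc c} p q b with b zero | prod-indicator p q (b ∘ suc)
... | true  | ih = trans (lem₁ p q _ _) (trans (cong ((p + q) * p *_) ih) (lem₂ p (p + q) _ _))
  where
  lem₁ : ∀ p q P y → (p + q * 1) * P * (p * y) ≡ (p + q) * p * (P * y)
  lem₁ = solve-∀
  lem₂ : ∀ p r z y → r * p * (z * y) ≡ r * z * (p * y)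
  lem₂ = solve-∀
... | false | ih = trans (lem₁ p q _ _) (trans (cong (p *_) ih) (lem₂ p ((p + q) ^ count (b ∘ suc)) (p ^ c)))
  where
  lem₁ : ∀ p q P y → (p + q * 0) * P * y ≡ p * (P * y)
  lem₁ = solve-∀
  lem₂ : ∀ p z y → p * (z * y) ≡ z * (p * y)
  lem₂ = solve-∀

-- Splitting a coordinate evenly

-- Addition in (ℤ/2)^t, reduced to the laws that make its tables Latin.
record Xor (n : ℕ) : Set where
  infixl 6 _⊕_
  field
    _⊕_        : Fin n → Fin n → Fin n
    comm       : ∀ a b → a ⊕ b ≡ b ⊕ a
    involutive : ∀ a b → a ⊕ (a ⊕ b) ≡ b

  translate : Fin n → Fin n ↔ Fin n
  translate a = mk↔ₛ′ (a ⊕_) (a ⊕_) (involutive a) (involutive a)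

  translateʳ : Fin n → Fin n ↔ Fin n
  translateʳ b = mk↔ₛ′ (_⊕ b) (_⊕ b) inv inv
    where
    inv : ∀ a → (a ⊕ b) ⊕ b ≡ a
    inv a = trans (comm (a ⊕ b) b) (trans (cong (b ⊕_) (comm a b)) (involutive b a))

Splitting : ℕ → ℕ → Set
Splitting N c = (Fin N × Fin c) ↔ Fin (N * c)

module _ {N c : ℕ} (X : Xor N) where
  open Xor X

  -- Each class `a` of N points is translated by `σ a`, so every part takes one point from each
  -- class. This is a bijection for any `σ`, and for random `σ` each part is a random transversal of
  -- the classes.
  shear : (Fin c → Fin N) → Splitting N c
  shear σ = mk↔ₛ′ to from to-from from-to
    where
    to : Fin N × Fin c → Fin (N * c)
    to (i , a) = combine (σ a ⊕ i) a
    from : Fin (N * c) → Fin N × Fin c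
    from x = let (i , a) = remQuot {N} c x in σ a ⊕ i , a
    to-from : ∀ x → to (from x) ≡ x
    to-from x = let (i , a) = remQuot {N} c x in
      trans (cong (λ i → combine i a) (involutive (σ a) i)) (combine-remQuot {N} c x)
    from-to : ∀ y → from (to y) ≡ y
    from-to (i , a) = trans (cong (λ (i , a) → σ a ⊕ i , a) (remQuot-combine {N} {c} (σ a ⊕ i) a))
      (cong (_, a) (involutive (σ a) i))

Fits : ∀ {N c} → Splitting N c → ℕ → (Fin (N * c) → Bool) → Set
Fits {N} τ u S = ∀ i → count (λ a → S (Inverse.to τ (i , a))) ≤ u

-- A Chernoff bound with tilt 1 + q/p and a union bound over the K N pairs of a set and a part:
-- `small` says that K N (1 + q/(N p))^M < (1 + q/p)^(u + 1).
module _ {K N c : ℕ} .{{_ : NonZero N}} (X : Xor N) (p q M u : ℕ) .{{_ : NonZero p}}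
  (small : K * N * p ^ suc u * (N * p + q) ^ M < (p + q) ^ suc u * (N * p) ^ M)
  (S : Fin K → Fin (N * c) → Bool) (S≤M : ∀ k → count (S k) ≤ M)
  where
  open Xor X

  private
    x = N * p

    split : Fin (K * N) → Fin K × Fin N
    split = remQuot {K} N

    hit : Fin (K * N) → Fin c → Fin N → Bool
    hit κ a v = S (proj₁ (split κ)) (combine (v ⊕ proj₂ (split κ)) a)

    sections : Fin (K * N) → Fin c → ℕ
    sections κ a = count (hit κ a)

    sum-weights : ∀ κ a → sum (λ v → p + q * 𝟙 (hit κ a v)) ≡ x + q * sections κ a
    sum-weights κ a = trans (∑-distrib-+ (λ _ → p) (λ v → q * 𝟙 (hit κ a v)))
      (cong₂ _+_ (sum-const N p) (sym (*-distribˡ-sum q (λ v → 𝟙 (hit κ a v)))))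

    sum-sections : ∀ κ → sum (sections κ) ≤ M
    sum-sections κ = begin
      sum (sections κ)
        -- Translation by `i` permutes the values `v`, so `sections` counts `S k` class by class
        -- whatever `i` is.
        ≡⟨ sum-cong-≗ {c} (λ a → sym (sum-permute (λ v → 𝟙 (S k (combine v a))) (translateʳ i))) ⟩
      sum {c} (λ a → sum {N} (λ v → 𝟙 (S k (combine v a))))
        ≡⟨ ∑-comm {c} {N} (λ a v → 𝟙 (S k (combine v a))) ⟩
      sum {N} (λ v → sum {c} (λ a → 𝟙 (S k (combine v a))))
        ≡⟨ sum-combine N {c} (𝟙 ∘ S k) ⟨
      count (S k)
        ≤⟨ S≤M k ⟩
      M ∎
      where
      open ≤-Reasoning
      k = proj₁ (split κ)
      i = proj₂ (split κ)

    instance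
      x≢0 : NonZero x
      x≢0 = m*n≢0 N p
      x^c≢0 : NonZero (x ^ c)
      x^c≢0 = m^n≢0 x c

    chosen = derandomise c {N} (λ _ → 1) (λ κ a v → p + q * 𝟙 (hit κ a v))
    σ = proj₁ chosen

    module _ (κ : Fin (K * N)) where
      open ≤-Reasoning
      h = count (λ a → hit κ a (σ a))
      G : Fin (K * N) → ℕ
      G κ = prod (λ a → p + q * 𝟙 (hit κ a (σ a)))

      -- The sum over all pairs, bounded by `derandomise`, dominates each of its terms; this does
      -- the work of the union bound.
      moment : N ^ c * G κ * x ^ M ≤ K * N * (x ^ c * (x + q) ^ M)
      moment = begin
        N ^ c * G κ * x ^ M
          ≤⟨ *-monoˡ-≤ (x ^ M) (*-monoʳ-≤ (N ^ c) (≤-trans (≤-reflexive (sym (*-identityˡ _))) (term≤sum (λ κ → 1 * G κ) κ))) ⟩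
        N ^ c * sum (λ κ → 1 * G κ) * x ^ M
          ≤⟨ *-monoˡ-≤ (x ^ M) (proj₂ chosen) ⟩
        sum (λ κ → 1 * prod (λ a → sum (λ v → p + q * 𝟙 (hit κ a v)))) * x ^ M
          ≡⟨ cong (_* x ^ M) (sum-cong-≗ λ κ → trans (*-identityˡ _) (prod-cong (sum-weights κ))) ⟩
        sum (λ κ → prod (λ a → x + q * sections κ a)) * x ^ M
          ≡⟨ *-distribʳ-sum (x ^ M) (λ κ → prod (λ a → x + q * sections κ a)) ⟩
        sum (λ κ → prod (λ a → x + q * sections κ a) * x ^ M)
          ≤⟨ sum≤* (x ^ c * (x + q) ^ M) (λ κ → ≤-trans (≤-reflexive (*-comm _ (x ^ M))) (prod-bound x q M (sections κ) (sum-sections κ))) ⟩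
        K * N * (x ^ c * (x + q) ^ M) ∎

      -- Exponential Markov inequality with base 1 + q / p, multiplied out.
      tail-bound : (p + q) ^ h * x ^ M ≤ K * N * p ^ h * (x + q) ^ M
      tail-bound = *-cancelˡ-≤ (x ^ c) (begin
        x ^ c * ((p + q) ^ h * x ^ M)
          ≡⟨ cong (_* ((p + q) ^ h * x ^ M)) (^-distribʳ-* c N p) ⟩
        N ^ c * p ^ c * ((p + q) ^ h * x ^ M)
          ≡⟨ lem₁ (N ^ c) (p ^ c) ((p + q) ^ h) (x ^ M) ⟩
        N ^ c * ((p + q) ^ h * p ^ c) * x ^ M
          ≡⟨ cong (λ y → N ^ c * y * x ^ M) (prod-indicator p q (λ a → hit κ a (σ a))) ⟨
        N ^ c * (G κ * p ^ h) * x ^ M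
          ≡⟨ lem₂ (N ^ c) (G κ) (p ^ h) (x ^ M) ⟩
        N ^ c * G κ * x ^ M * p ^ h
          ≤⟨ *-monoˡ-≤ (p ^ h) moment ⟩
        K * N * (x ^ c * (x + q) ^ M) * p ^ h
          ≡⟨ lem₃ (K * N) (x ^ c) ((x + q) ^ M) (p ^ h) ⟩
        x ^ c * (K * N * p ^ h * (x + q) ^ M) ∎)
        where
        lem₁ : ∀ a b c d → a * b * (c * d) ≡ a * (c * b) * d
        lem₁ = solve-∀
        lem₂ : ∀ a b c d → a * (b * c) * d ≡ a * b * d * c
        lem₂ = solve-∀
        lem₃ : ∀ a b c d → a * (b * c) * d ≡ b * (a * d * c)
        lem₃ = solve-∀

      few-hits : h ≤ u
      few-hits with h ≤? u
      ... | yes h≤u = h≤u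
      ... | no  h≰u = contradiction tail-bound (<⇒≱ (begin-strict
        K * N * p ^ h * (x + q) ^ M
          ≡⟨ cong (λ h → K * N * p ^ h * (x + q) ^ M) h≡ ⟩
        K * N * p ^ (suc u + e) * (x + q) ^ M
          ≡⟨ cong (λ y → K * N * y * (x + q) ^ M) (^-distribˡ-+-* p (suc u) e) ⟩
        K * N * (p ^ suc u * p ^ e) * (x + q) ^ M
          ≡⟨ lem₁ (K * N) (p ^ suc u) (p ^ e) ((x + q) ^ M) ⟩
        K * N * p ^ suc u * (x + q) ^ M * p ^ e
          <⟨ *-monoˡ-< (p ^ e) {{m^n≢0 p e}} small ⟩
        (p + q) ^ suc u * x ^ M * p ^ e
          ≤⟨ *-monoʳ-≤ ((p + q) ^ suc u * x ^ M) (^-monoˡ-≤ e (m≤m+n p q)) ⟩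
        (p + q) ^ suc u * x ^ M * (p + q) ^ e
          ≡⟨ lem₂ ((p + q) ^ suc u) (x ^ M) ((p + q) ^ e) ⟩
        (p + q) ^ suc u * (p + q) ^ e * x ^ M
          ≡⟨ cong (_* x ^ M) (^-distribˡ-+-* (p + q) (suc u) e) ⟨
        (p + q) ^ (suc u + e) * x ^ M
          ≡⟨ cong (λ h → (p + q) ^ h * x ^ M) h≡ ⟨
        (p + q) ^ h * x ^ M ∎))
        where
        e = h ∸ suc u
        h≡ : h ≡ suc u + e
        h≡ = sym (m+[n∸m]≡n (≰⇒> h≰u))
        lem₁ : ∀ a b c d → a * (b * c) * d ≡ a * b * d * c
        lem₁ = solve-∀
        lem₂ : ∀ a b c → a * b * c ≡ a * c * b
        lem₂ = solve-∀

  splitting : Σ[ τ ∈ Splitting N c ] ∀ k → Fits τ u (S k)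
  splitting = shear X σ , λ k i →
    subst (λ (k , i) → count (λ a → S k (combine (σ a ⊕ i) a)) ≤ u) (remQuot-combine k i) (few-hits (combine k i))

-- The sets are indexed by the three fixed coordinates of a line. `K` only bounds their number, so
-- one numerical hypothesis serves index ranges of different sizes.
splitting₃ : ∀ {k₁ k₂ k₃ N c} .{{_ : NonZero N}} (X : Xor N) (K p q M u : ℕ) .{{_ : NonZero p}} →
  k₁ * (k₂ * k₃) ≤ K →
  K * N * p ^ suc u * (N * p + q) ^ M < (p + q) ^ suc u * (N * p) ^ M →
  (S : Fin k₁ → Fin k₂ → Fin k₃ → Fin (N * c) → Bool) → (∀ x y z → count (S x y z) ≤ M) →
  Σ[ τ ∈ Splitting N c ] ∀ x y z → Fits τ u (S x y z)
splitting₃ {k₁} {k₂} {k₃} {N} {c} X K p q M u k≤K small S S≤M = τ , λ x y z i →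
  subst (λ (y , z) → count (λ a → S x y z (Inverse.to τ (i , a))) ≤ u) (remQuot-combine y z)
    (subst (λ (x , yz) → count (λ a → uncurry (S x) (remQuot {k₂} k₃ yz) (Inverse.to τ (i , a))) ≤ u)
      (remQuot-combine x (combine y z)) (fits (combine x (combine y z)) i))
  where
  S′ : Fin (k₁ * (k₂ * k₃)) → Fin (N * c) → Bool
  S′ k = let (x , yz) = remQuot {k₁} (k₂ * k₃) k ; (y , z) = remQuot {k₂} k₃ yz in S x y z
  found = splitting X p q M u
    (≤-<-trans (*-monoˡ-≤ ((N * p + q) ^ M) (*-monoˡ-≤ (p ^ suc u) (*-monoˡ-≤ N k≤K))) small)
    S′ (λ k → S≤M _ _ _)
  τ = proj₁ found
  fits = proj₂ found

-- Latin cubes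

xor₁ : Xor 1
xor₁ = record { _⊕_ = λ _ b → b ; comm = λ { 0F 0F → refl } ; involutive = λ _ _ → refl }

xor₂ : Xor 2
xor₂ = record
  { _⊕_ = λ { 0F b → b ; 1F 0F → 1F ; 1F 1F → 0F }
  ; comm = λ { 0F 0F → refl ; 0F 1F → refl ; 1F 0F → refl ; 1F 1F → refl }
  ; involutive = λ { 0F _ → refl ; 1F 0F → refl ; 1F 1F → refl }
  }

xor-× : ∀ {m n} → Xor m → Xor n → Xor (m * n)
xor-× {m} {n} X Y = record
  { _⊕_ = λ x y → combine (dig₁ x ⊕₁ dig₁ y) (dig₂ x ⊕₂ dig₂ y)
  ; comm = λ x y → cong₂ combine (Xor.comm X (dig₁ x) (dig₁ y)) (Xor.comm Y (dig₂ x) (dig₂ y))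
  ; involutive = λ x y → trans
      (cong (λ (i , j) → combine (dig₁ x ⊕₁ i) (dig₂ x ⊕₂ j)) (remQuot-combine (dig₁ x ⊕₁ dig₁ y) (dig₂ x ⊕₂ dig₂ y)))
      (trans (cong₂ combine (Xor.involutive X (dig₁ x) (dig₁ y)) (Xor.involutive Y (dig₂ x) (dig₂ y)))
        (combine-remQuot {m} n y))
  }
  where
  open Xor X using () renaming (_⊕_ to _⊕₁_)
  open Xor Y using () renaming (_⊕_ to _⊕₂_)
  dig₁ : Fin (m * n) → Fin m
  dig₁ = proj₁ ∘ remQuot {m} n
  dig₂ : Fin (m * n) → Fin n
  dig₂ = proj₂ ∘ remQuot {m} n

xor : ∀ t → Xor (2 ^ t)
xor zero    = xor₁
xor (suc t) = xor-× xor₂ (xor t)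

↔-once : ∀ {A B : Set} (f : A ↔ B) s → ∃! _≡_ λ x → Inverse.to f x ≡ s
↔-once f s = Inverse.from f s , Inverse.strictlyInverseˡ f s ,
  λ { refl → Inverse.strictlyInverseʳ f _ }

module _ {n} (X : Xor n) where
  open Xor X

  -- Bracketed so that along every line it is a composite of translations.
  shifted : Fin n → Cube (Fin n) n
  shifted g a b d = g ⊕ (d ⊕ (a ⊕ b))

  shifted-latin : ∀ g → IsLatinCube (shifted g)
  shifted-latin g = record
    { row-once    = λ s a d → ↔-once (translate g ↔-∘ (translate d ↔-∘ translate a)) s
    ; column-once = λ s b d → ↔-once (translate g ↔-∘ (translate d ↔-∘ translateʳ b)) s
    ; file-once   = λ s a b → ↔-once (translate g ↔-∘ translateʳ (a ⊕ b)) s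
    }

-- F x y z w holds when the symbol w is forbidden in the cell (x , y , z), so cells become lines like the others.
Relation : ℕ → Set
Relation n = (x y z w : Fin n) → Bool

record Sparse (m : ℕ) {n} (F : Relation n) : Set where
  field
    along-x : ∀ y z w → count (λ x → F x y z w) ≤ m
    along-y : ∀ x z w → count (λ y → F x y z w) ≤ m
    along-z : ∀ x y w → count (λ z → F x y z w) ≤ m
    along-w : ∀ x y z → count (λ w → F x y z w) ≤ m

Evadable : ∀ {n} → Relation n → Set
Evadable {n} F = Σ[ L ∈ Cube (Fin n) n ] (IsLatinCube L × (∀ x y z → F x y z (L x y z) ≡ false))

AllEvadable : ℕ → ℕ → Set
AllEvadable n m = (F : Relation n) → Sparse m F → Evadable F

weaken : ∀ {n m m′} → m ≤ m′ → AllEvadable n m′ → AllEvadable n m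
weaken m≤m′ P F sp = P F record
  { along-x = λ y z w → ≤-trans (along-x y z w) m≤m′
  ; along-y = λ y z w → ≤-trans (along-y y z w) m≤m′
  ; along-z = λ y z w → ≤-trans (along-z y z w) m≤m′
  ; along-w = λ y z w → ≤-trans (along-w y z w) m≤m′
  }
  where open Sparse sp

-- Inflating Latin cubes blockwise

module _ {N c} (τ₁ τ₂ τ₃ τ₄ : Splitting N c) where
  private
    module τ₁ = Inverse τ₁
    module τ₂ = Inverse τ₂
    module τ₃ = Inverse τ₃
    module τ₄ = Inverse τ₄

  module _ (Λ : Cube (Fin N) N) (M : Cube (Cube (Fin c) c) N) where

    product : Cube (Fin (N * c)) (N * c)
    product x y z =
      let (i , a) = τ₁.from x ; (j , b) = τ₂.from y ; (k , d) = τ₃.from z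
      in τ₄.to (Λ i j k , M i j k a b d)

    -- On a line, the part of the symbol determines the outer coordinate through `Λ`; the inner
    -- symbol then determines the inner coordinate through the cube of that block. Hence the inner
    -- cubes may be chosen independently.
    product-latin : IsLatinCube Λ → (∀ i j k → IsLatinCube (M i j k)) → IsLatinCube product
    product-latin Λ-latin M-latin = record
      { row-once = λ s x z →
          let (i , a) = τ₁.from x ; (k , d) = τ₃.from z
          in once τ₂ (λ j → Λ i j k) (λ j b → M i j k a b d)
               (λ l → row-once Λ-latin l i k) (λ j e → row-once (M-latin i j k) e a d) s
      ; column-once = λ s y z →
          let (j , b) = τ₂.from y ; (k , d) = τ₃.from z
          in once τ₁ (λ i → Λ i j k) (λ i a → M i j k a b d)
               (λ l → column-once Λ-latin l j k) (λ i e → column-once (M-latin i j k) e b d) s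
      ; file-once = λ s x y →
          let (i , a) = τ₁.from x ; (j , b) = τ₂.from y
          in once τ₃ (λ k → Λ i j k) (λ k d → M i j k a b d)
               (λ l → file-once Λ-latin l i j) (λ k e → file-once (M-latin i j k) e a b) s
      }
      where
      open IsLatinCube
      once : (τ : Splitting N c) (f : Fin N → Fin N) (g : Fin N → Fin c → Fin c) →
        (∀ l → ∃! _≡_ λ j → f j ≡ l) → (∀ j e → ∃! _≡_ λ b → g j b ≡ e) →
        ∀ s → ∃! _≡_ λ y → let (j , b) = Inverse.from τ y in τ₄.to (f j , g j b) ≡ s
      once τ f g f-once g-once s = Inverse.to τ (j , b) , solves , unique
        where
        l = proj₁ (τ₄.from s)
        e = proj₂ (τ₄.from s)
        j = proj₁ (f-once l)
        b = proj₁ (g-once j e)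
        solves : let (j , b) = Inverse.from τ (Inverse.to τ (j , b)) in τ₄.to (f j , g j b) ≡ s
        solves = trans (cong (λ (j , b) → τ₄.to (f j , g j b)) (Inverse.strictlyInverseʳ τ (j , b)))
          (trans (cong₂ (λ l e → τ₄.to (l , e)) (proj₁ (proj₂ (f-once l))) (proj₁ (proj₂ (g-once j e))))
            (τ₄.strictlyInverseˡ s))
        unique : ∀ {y} → (let (j , b) = Inverse.from τ y in τ₄.to (f j , g j b) ≡ s) → Inverse.to τ (j , b) ≡ y
        unique {y} eq = trans (cong (Inverse.to τ) (pair j≡j′ b≡)) (Inverse.strictlyInverseˡ τ y)
          where
          j′ = proj₁ (Inverse.from τ y)
          b′ = proj₂ (Inverse.from τ y)
          le : (f j′ , g j′ b′) ≡ (l , e)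
          le = trans (sym (τ₄.strictlyInverseʳ _)) (cong τ₄.from eq)
          j≡j′ : j ≡ j′
          j≡j′ = proj₂ (proj₂ (f-once l)) (proj₁ (,-injective le))
          b≡ : proj₁ (g-once j′ e) ≡ b′
          b≡ = proj₂ (proj₂ (g-once j′ e)) (proj₂ (,-injective le))
          pair : ∀ {j′ b′} → j ≡ j′ → proj₁ (g-once j′ e) ≡ b′ → (j , b) ≡ (j′ , b′)
          pair refl refl = refl

  block : Relation (N * c) → (i j k l : Fin N) → Relation c
  block F i j k l a b d e = F (τ₁.to (i , a)) (τ₂.to (j , b)) (τ₃.to (k , d)) (τ₄.to (l , e))

  -- Cells of the block (i, j, k) receive only symbols of part `Λ i j k`, so all their conflicts lie
  -- in one four-dimensional block.
  assemble : (Λ : Cube (Fin N) N) → IsLatinCube Λ →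
    (F : Relation (N * c)) → (∀ i j k l → Evadable (block F i j k l)) → Evadable F
  assemble Λ Λ-latin F blocks = product Λ M , product-latin Λ M Λ-latin M-latin , evades
    where
    M : Cube (Cube (Fin c) c) N
    M i j k = proj₁ (blocks i j k (Λ i j k))
    M-latin : ∀ i j k → IsLatinCube (M i j k)
    M-latin i j k = proj₁ (proj₂ (blocks i j k (Λ i j k)))
    evades : ∀ x y z → F x y z (product Λ M x y z) ≡ false
    evades x y z = trans
      (sym (cong₂ (λ x′ (y′ , z′) → F x′ y′ z′ (product Λ M x y z)) (τ₁.strictlyInverseˡ x)
        (cong₂ _,_ (τ₂.strictlyInverseˡ y) (τ₃.strictlyInverseˡ z))))
      (proj₂ (proj₂ (blocks i j k (Λ i j k))) a b d)
      where
      i = proj₁ (τ₁.from x)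
      a = proj₂ (τ₁.from x)
      j = proj₁ (τ₂.from y)
      b = proj₂ (τ₂.from y)
      k = proj₁ (τ₃.from z)
      d = proj₂ (τ₃.from z)

boolean : ∀ t → Σ[ Λ ∈ Cube (Fin (2 ^ t)) (2 ^ t) ] IsLatinCube Λ
boolean t = shifted (xor t) (origin t) , shifted-latin (xor t) (origin t)
  where
  origin : ∀ t → Fin (2 ^ t)
  origin zero    = 0F
  origin (suc t) = combine {2} 0F (origin t)

blocks-evadable : ∀ {s c u} → let N = 2 ^ s in AllEvadable c u → (F : Relation (N * c)) → (τ₁ τ₂ τ₃ τ₄ : Splitting N c) →
  (∀ y z w → Fits τ₁ u (λ x → F x y z w)) → (∀ x z w → Fits τ₂ u (λ y → F x y z w)) →
  (∀ x y w → Fits τ₃ u (λ z → F x y z w)) → (∀ x y z → Fits τ₄ u (λ w → F x y z w)) → Evadable F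
blocks-evadable {s} P F τ₁ τ₂ τ₃ τ₄ fits₁ fits₂ fits₃ fits₄ =
  assemble τ₁ τ₂ τ₃ τ₄ (proj₁ (boolean s)) (proj₂ (boolean s)) F λ i j k l →
    P (block τ₁ τ₂ τ₃ τ₄ F i j k l) record
      { along-x = λ _ _ _ → fits₁ _ _ _ i
      ; along-y = λ _ _ _ → fits₂ _ _ _ j
      ; along-z = λ _ _ _ → fits₃ _ _ _ k
      ; along-w = λ _ _ _ → fits₄ _ _ _ l
      }

-- Restricting a line to a part cannot raise its count, so the plain splitting keeps `m`. This
-- reaches odd exponents and, from order 1, the small orders.
blow-up : ∀ s {c m} → AllEvadable c m → AllEvadable (2 ^ s * c) m
blow-up s {c} {m} P F sp = blocks-evadable {s} P F τ τ τ τ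
  (λ y z w → fits _ (along-x y z w)) (λ y z w → fits _ (along-y y z w))
  (λ y z w → fits _ (along-z y z w)) (λ y z w → fits _ (along-w y z w))
  where
  open Sparse sp
  N = 2 ^ s
  τ : Splitting N c
  τ = mk↔ₛ′ (uncurry combine) (remQuot {N} c) (combine-remQuot {N} c) (uncurry remQuot-combine)
  fits : (S : Fin (N * c) → Bool) → count S ≤ m → Fits τ m S
  fits S S≤m i = ≤-trans (term≤sum (λ i → count (λ a → S (combine i a))) i)
    (≤-trans (≤-reflexive (sym (sum-combine N (𝟙 ∘ S)))) S≤m)

-- Blocks with few conflicts

positive : ℕ → Bool
positive zero    = false
positive (suc _) = true

𝟙-positive≤ : ∀ n → 𝟙 (positive n) ≤ n
𝟙-positive≤ zero    = z≤n
𝟙-positive≤ (suc n) = s≤s z≤n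

≤*𝟙-positive : ∀ {n u} → n ≤ u → n ≤ u * 𝟙 (positive n)
≤*𝟙-positive {zero}  n≤u = z≤n
≤*𝟙-positive {suc n} n≤u = ≤-trans n≤u (≤-reflexive (sym (*-identityʳ _)))

some : ∀ {n} → (Fin n → Bool) → Bool
some f = positive (count f)

count-some : ∀ {c n m} (G : Fin c → Fin n → Bool) → (∀ a → count (G a) ≤ m) →
  count (λ y → some (λ a → G a y)) ≤ c * m
count-some {c} {m = m} G G≤m = begin
  count (λ y → some (λ a → G a y))   ≤⟨ sum-mono (λ y → 𝟙-positive≤ (count (λ a → G a y))) ⟩
  sum (λ y → count (λ a → G a y))    ≡⟨ ∑-comm {n = c} (λ y a → 𝟙 (G a y)) ⟩
  sum {c} (λ a → count (G a))        ≤⟨ sum≤* m G≤m ⟩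
  c * m                              ∎
  where open ≤-Reasoning

-- At most `u` indices contribute, each at most `v`. Keeping the indicator in the bound lets the
-- lemma be applied again to the next coordinate.
sum≤some : ∀ {c} v u (g : Fin c → ℕ) (f : Fin c → Bool) →
  (∀ x → g x ≤ v * 𝟙 (f x)) → count f ≤ u → sum g ≤ v * u * 𝟙 (some f)
sum≤some v u g f g≤ f≤u = begin
  sum g                   ≤⟨ sum-mono g≤ ⟩
  sum (λ x → v * 𝟙 (f x)) ≡⟨ *-distribˡ-sum v (𝟙 ∘ f) ⟨
  v * count f             ≤⟨ *-monoʳ-≤ v (≤*𝟙-positive f≤u) ⟩
  v * (u * 𝟙 (some f))    ≡⟨ *-assoc v u _ ⟨
  v * u * 𝟙 (some f)      ∎
  where open ≤-Reasoning

-- The symbol is outermost because the coordinate split last is the first to be peeled off when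
-- conflicts are counted.
total : ∀ {c} → (Fin c → Fin c → Fin c → Fin c → ℕ) → ℕ
total h = sum λ e → sum λ d → sum λ b → sum λ a → h a b d e

total-rotate : ∀ {c} (h : Fin c → Fin c → Fin c → Fin c → ℕ) →
  total h ≡ sum λ d → sum λ b → sum λ a → sum λ e → h a b d e
total-rotate {c} h =
  trans (∑-comm {c} {c} (λ e d → sum λ b → sum λ a → h a b d e)) (sum-cong-≗ {c} λ d →
  trans (∑-comm {c} {c} (λ e b → sum λ a → h a b d e)) (sum-cong-≗ {c} λ b →
  ∑-comm {c} {c} (λ e a → h a b d e)))

𝟙≡0 : ∀ {b} → 𝟙 b ≤ 0 → b ≡ false
𝟙≡0 {false} _ = refl

-- The c shifts are pairwise disjoint, so fewer than c forbidden entries spare one of them.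
evade-by-shift : ∀ {c} .{{_ : NonZero c}} → Xor c → (F : Relation c) →
  total (λ a b d e → 𝟙 (F a b d e)) < c → Evadable F
evade-by-shift {c} X F total<c = shifted X g , shifted-latin X g , λ a b d → 𝟙≡0 (begin
  𝟙 (F a b d (shifted X g a b d))
    ≤⟨ term≤sum (λ a → 𝟙 (F a b d (shifted X g a b d))) a ⟩
  sum (λ a → 𝟙 (F a b d (shifted X g a b d)))
    ≤⟨ term≤sum (λ b → sum λ a → 𝟙 (F a b d (shifted X g a b d))) b ⟩
  sum (λ b → sum λ a → 𝟙 (F a b d (shifted X g a b d)))
    ≤⟨ term≤sum (λ d → sum λ b → sum λ a → 𝟙 (F a b d (shifted X g a b d))) d ⟩
  conflicts g
    ≤⟨ none ⟩
  0 ∎)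
  where
  open ≤-Reasoning
  open Xor X
  conflicts : Fin c → ℕ
  conflicts g = sum λ d → sum λ b → sum λ a → 𝟙 (F a b d (shifted X g a b d))
  avg = averaging c conflicts
  g = proj₁ avg
  all-shifts : sum conflicts ≡ total (λ a b d e → 𝟙 (F a b d e))
  all-shifts =
    trans (total-rotate (λ a b d g → 𝟙 (F a b d (shifted X g a b d))))
    (trans (sum-cong-≗ {c} λ d → sum-cong-≗ {c} λ b → sum-cong-≗ {c} λ a →
      sym (sum-permute (λ e → 𝟙 (F a b d e)) (translateʳ (d ⊕ (a ⊕ b)))))
    (sym (total-rotate (λ a b d e → 𝟙 (F a b d e)))))
  none : conflicts g ≤ 0
  none = ≤-pred (*-cancelˡ-< c (conflicts g) 1 (begin-strict
    c * conflicts g    ≤⟨ proj₂ avg ⟩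
    sum conflicts      ≡⟨ all-shifts ⟩
    total (λ a b d e → 𝟙 (F a b d e)) <⟨ total<c ⟩
    c                  ≡⟨ *-identityʳ c ⟨
    c * 1              ∎))

module _ (s : ℕ) {c : ℕ} .{{_ : NonZero c}} (Y : Xor c) (p q m u : ℕ) .{{_ : NonZero p}} where
  private
    N = 2 ^ s
    n = N * c
    -- In the last splitting, each set is a union over c³ choices in the three coordinates already
    -- split; the earlier bounds are padded to this one.
    M = c * (c * (c * m))
    X = xor s
    instance
      N≢0 : NonZero N
      N≢0 = m^n≢0 2 s

  conflict-free-shifts :
    n * (n * n) * N * p ^ suc u * (N * p + q) ^ M < (p + q) ^ suc u * (N * p) ^ M →
    1 * u * u * u * u < c → AllEvadable n m
  conflict-free-shifts small u⁴<c F sp =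
    assemble τ₁ τ₂ τ₃ τ₄ (proj₁ (boolean s)) (proj₂ (boolean s)) F λ i j k l →
      evade-by-shift Y (block τ₁ τ₂ τ₃ τ₄ F i j k l) (≤-<-trans (few i j k l) u⁴<c)
    where
    open Sparse sp

    N≤n : N ≤ n
    N≤n = m≤m*n N c
    m≤cm : ∀ m → m ≤ c * m
    m≤cm m = m≤n*m m c

    -- Once a coordinate is split, it is only looked at blockwise (F₁, F₂, F₃), so that splitting the later
    -- coordinates cannot destroy the bounds already obtained; a block then has at most u⁴ conflicts.
    one : Σ[ τ ∈ Splitting N c ] ∀ y z w → Fits τ u (λ x → F x y z w)
    one = splitting₃ X (n * (n * n)) p q M u ≤-refl small (λ y z w x → F x y z w)
      (λ y z w → ≤-trans (along-x y z w) (≤-trans (m≤cm _) (≤-trans (m≤cm _) (m≤cm _))))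
    τ₁ = proj₁ one
    F₁ : Fin N → Fin n → Fin n → Fin n → Bool
    F₁ i y z w = some λ a → F (Inverse.to τ₁ (i , a)) y z w

    two : Σ[ τ ∈ Splitting N c ] ∀ i z w → Fits τ u (λ y → F₁ i y z w)
    two = splitting₃ X (n * (n * n)) p q M u (*-monoˡ-≤ (n * n) N≤n) small (λ i z w y → F₁ i y z w)
      (λ i z w → ≤-trans (count-some (λ a y → F (Inverse.to τ₁ (i , a)) y z w) (λ a → along-y _ z w)) (≤-trans (m≤cm _) (m≤cm _)))
    τ₂ = proj₁ two
    F₂ : Fin N → Fin N → Fin n → Fin n → Bool
    F₂ i j z w = some λ b → F₁ i (Inverse.to τ₂ (j , b)) z w

    three : Σ[ τ ∈ Splitting N c ] ∀ i j w → Fits τ u (λ z → F₂ i j z w)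
    three = splitting₃ X (n * (n * n)) p q M u (*-mono-≤ N≤n (*-monoˡ-≤ n N≤n)) small (λ i j w z → F₂ i j z w)
      (λ i j w → ≤-trans (count-some (λ b z → F₁ i (Inverse.to τ₂ (j , b)) z w)
        (λ b → count-some (λ a z → F (Inverse.to τ₁ (i , a)) (Inverse.to τ₂ (j , b)) z w) (λ a → along-z _ _ w))) (m≤cm _))
    τ₃ = proj₁ three
    F₃ : Fin N → Fin N → Fin N → Fin n → Bool
    F₃ i j k w = some λ d → F₂ i j (Inverse.to τ₃ (k , d)) w

    four : Σ[ τ ∈ Splitting N c ] ∀ i j k → Fits τ u (λ w → F₃ i j k w)
    four = splitting₃ X (n * (n * n)) p q M u (*-mono-≤ N≤n (*-mono-≤ N≤n N≤n)) small F₃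
      (λ i j k → count-some (λ d → F₂ i j (Inverse.to τ₃ (k , d)))
        (λ d → count-some (λ b → F₁ i (Inverse.to τ₂ (j , b)) (Inverse.to τ₃ (k , d)))
          (λ b → count-some (λ a → F (Inverse.to τ₁ (i , a)) (Inverse.to τ₂ (j , b)) (Inverse.to τ₃ (k , d)))
            (λ a → along-w _ _ _))))
    τ₄ = proj₁ four

    few : ∀ i j k l → total (λ a b d e → 𝟙 (block τ₁ τ₂ τ₃ τ₄ F i j k l a b d e)) ≤ 1 * u * u * u * u
    few i j k l = ≤-trans
      (sum≤some (1 * u * u * u) u _ (λ e → F₃ i j k (Inverse.to τ₄ (l , e)))
        (λ e → sum≤some (1 * u * u) u _ (λ d → F₂ i j (Inverse.to τ₃ (k , d)) (Inverse.to τ₄ (l , e)))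
          (λ d → sum≤some (1 * u) u _ (λ b → F₁ i (Inverse.to τ₂ (j , b)) _ _)
            (λ b → sum≤some 1 u _ (λ a → F (Inverse.to τ₁ (i , a)) _ _ _)
              (λ a → ≤-reflexive (sym (*-identityˡ _)))
              (proj₂ one _ _ _ i))
            (proj₂ two i _ _ j))
          (proj₂ three i j _ k))
        (proj₂ four i j k l))
      (≤-trans (*-monoʳ-≤ (1 * u * u * u * u) (𝟙≤1 _)) (≤-reflexive (*-identityʳ _)))
      where
      𝟙≤1 : ∀ b → 𝟙 b ≤ 1
      𝟙≤1 true  = ≤-refl
      𝟙≤1 false = z≤n

-- Numerical estimates

-- This is (1 + 1/D)^k ≤ 1 / (1 - k/D). Each factor 1 + 1/D turns `d` into at most d + 1, because d
-- ≤ D.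
1+D-power : ∀ D k d → k + d ≡ D → suc D ^ k * d ≤ D ^ k * D
1+D-power D zero    d refl = ≤-refl
1+D-power D (suc k) d eq = begin
  suc D * suc D ^ k * d     ≡⟨ lem₁ (suc D) (suc D ^ k) d ⟩
  suc D ^ k * (d + D * d)   ≤⟨ *-monoʳ-≤ (suc D ^ k) (+-monoˡ-≤ (D * d) d≤D) ⟩
  suc D ^ k * (D + D * d)   ≡⟨ lem₂ (suc D ^ k) D d ⟩
  D * (suc D ^ k * suc d)   ≤⟨ *-monoʳ-≤ D (1+D-power D k (suc d) (trans (+-suc k d) eq)) ⟩
  D * (D ^ k * D)           ≡⟨ *-assoc D (D ^ k) D ⟨
  D * D ^ k * D             ∎
  where
  open ≤-Reasoning
  d≤D : d ≤ D
  d≤D = ≤-trans (m≤n+m d (suc k)) (≤-reflexive eq)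
  lem₁ : ∀ D y d → D * y * d ≡ y * (D * d)
  lem₁ = solve-∀
  lem₂ : ∀ y D d → y * (D + D * d) ≡ D * (y * (1 + d))
  lem₂ = solve-∀

1+D-power≤2 : ∀ D k → 2 * k ≤ D → suc D ^ k ≤ 2 * D ^ k
-- Separate because `D` may be 0 here, and then `d` could not be cancelled.
1+D-power≤2 D zero    _    = s≤s z≤n
1+D-power≤2 D k@(suc _) 2k≤D = *-cancelʳ-≤ (suc D ^ k) (2 * D ^ k) d {{d≢0}} (begin
  suc D ^ k * d      ≤⟨ 1+D-power D k d k+d≡D ⟩
  D ^ k * D          ≤⟨ *-monoʳ-≤ (D ^ k) D≤2d ⟩
  D ^ k * (2 * d)    ≡⟨ lem (D ^ k) d ⟩
  2 * D ^ k * d      ∎)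
  where
  open ≤-Reasoning
  d = D ∸ k
  k≤D : k ≤ D
  k≤D = ≤-trans (m≤m+n k (k + 0)) 2k≤D
  k+d≡D : k + d ≡ D
  k+d≡D = m+[n∸m]≡n k≤D
  k≤d : k ≤ d
  k≤d = +-cancelˡ-≤ k k d (≤-trans (≤-reflexive (cong (k +_) (sym (+-identityʳ k)))) (≤-trans 2k≤D (≤-reflexive (sym k+d≡D))))
  d≢0 : NonZero d
  d≢0 = >-nonZero (≤-trans (s≤s z≤n) k≤d)
  D≤2d : D ≤ 2 * d
  D≤2d = ≤-trans (≤-reflexive (sym k+d≡D)) (+-mono-≤ k≤d (m≤m+n d 0))
  lem : ∀ y d → y * (2 * d) ≡ 2 * y * d
  lem = solve-∀

2r^r≤[r+1]^r : ∀ r .{{_ : NonZero r}} → 2 * r ^ r ≤ (r + 1) ^ r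
2r^r≤[r+1]^r r = *-cancelˡ-≤ r (≤-trans (≤-reflexive (lem r (r ^ r))) (bernoulli r 1 r))
  where
  lem : ∀ r y → r * (2 * y) ≡ y * (r + 1 * r)
  lem = solve-∀

-- This is (1 + 1/(4r))^4 ≤ (1 + 1/r)(1 + 1/(2r²)): the first-order terms agree, and 3/8 < 1/2 in
-- second order.
quartic : ∀ r .{{_ : NonZero r}} → let D = 2 * (r * r) in
  r * D * (4 * r + 1) ^ 4 ≤ suc D * ((r + 1) * (4 * r) ^ 4)
-- Writing r = 1 + s makes the difference of the sides, r³(64r² + 224r - 2), a polynomial with
-- natural coefficients.
quartic r@(suc s) = ≤-trans (m≤m+n _ _) (≤-reflexive (lem s))
  where
  lem : ∀ s → let r = 1 + s ; x = 4 * r + 1 ; y = 4 * r in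
    r * (2 * (r * r)) * (x * (x * (x * (x * 1)))) + r * r * r * (64 * r * r + 222 * r + 2 * s)
    ≡ (1 + 2 * (r * r)) * ((r + 1) * (y * (y * (y * (y * 1)))))
  lem = solve-∀

module _ (r k : ℕ) .{{_ : NonZero r}} where
  private
    D = 2 * (r * r)
    instance
      D≢0 : NonZero D
      D≢0 = m*n≢0 2 (r * r) {{_}} {{m*n≢0 r r}}
      D^k≢0 : NonZero (D ^ k)
      D^k≢0 = m^n≢0 D k
      r+1≢0 : NonZero (r + 1)
      r+1≢0 = >-nonZero (m≤n+m 1 r)
    A = r ^ k
    B = (4 * r + 1) ^ (4 * k)
    C = (r + 1) ^ k
    E = (4 * r) ^ (4 * k)

  -- The `k`-th power of `quartic`; k ≤ r² keeps the error (1 + 1/(2r²))^k at most 2.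
  quartic-power : k ≤ r * r → A * B ≤ 2 * (C * E)
  quartic-power k≤r² = *-cancelˡ-≤ (D ^ k) (begin
    D ^ k * (A * B)
      ≡⟨ lem₁ (D ^ k) A B ⟩
    A * D ^ k * B
      ≡⟨ cong₂ _*_ (sym (^-distribʳ-* k r D)) (sym (^-*-assoc (4 * r + 1) 4 k)) ⟩
    (r * D) ^ k * ((4 * r + 1) ^ 4) ^ k
      ≡⟨ ^-distribʳ-* k (r * D) ((4 * r + 1) ^ 4) ⟨
    (r * D * (4 * r + 1) ^ 4) ^ k
      ≤⟨ ^-monoˡ-≤ k (quartic r) ⟩
    (suc D * ((r + 1) * (4 * r) ^ 4)) ^ k
      ≡⟨ ^-distribʳ-* k (suc D) _ ⟩
    suc D ^ k * ((r + 1) * (4 * r) ^ 4) ^ k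
      ≡⟨ cong (suc D ^ k *_) (trans (^-distribʳ-* k (r + 1) ((4 * r) ^ 4)) (cong (C *_) (^-*-assoc (4 * r) 4 k))) ⟩
    suc D ^ k * (C * E)
      ≤⟨ *-monoˡ-≤ (C * E) (1+D-power≤2 D k (*-monoʳ-≤ 2 k≤r²)) ⟩
    2 * D ^ k * (C * E)
      ≡⟨ lem₂ (D ^ k) (C * E) ⟩
    D ^ k * (2 * (C * E)) ∎)
    where
    open ≤-Reasoning
    lem₁ : ∀ x y z → x * (y * z) ≡ y * x * z
    lem₁ = solve-∀
    lem₂ : ∀ x y → 2 * x * y ≡ x * (2 * y)
    lem₂ = solve-∀

  -- The Chernoff condition for N = 4 with tilt 1 + 1/r. In the exponent, `k` pays for the mean up
  -- to a factor 2, `r * a` gains 2^a since (1 + 1/r)^r ≥ 2, and the remaining 1 gives strictness.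
  quarter-small : ∀ Q a → k ≤ r * r → 2 * Q ≤ 2 ^ a →
    Q * r ^ suc (k + r * a) * (4 * r + 1) ^ (4 * k) < (r + 1) ^ suc (k + r * a) * (4 * r) ^ (4 * k)
  quarter-small Q a k≤r² 2Q≤2^a = begin-strict
    Q * (r * r ^ (k + r * a)) * B
      ≡⟨ cong (λ y → Q * (r * y) * B) (^-distribˡ-+-* r k (r * a)) ⟩
    Q * (r * (A * r ^ (r * a))) * B
      ≡⟨ lem₁ Q r A (r ^ (r * a)) B ⟩
    Q * r ^ (r * a) * r * (A * B)
      ≤⟨ *-monoʳ-≤ (Q * r ^ (r * a) * r) (quartic-power k≤r²) ⟩
    Q * r ^ (r * a) * r * (2 * (C * E))
      ≡⟨ lem₂ Q (r ^ (r * a)) r (C * E) ⟩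
    2 * Q * r ^ (r * a) * r * (C * E)
      ≤⟨ *-monoˡ-≤ (C * E) (*-monoˡ-≤ r (*-monoˡ-≤ (r ^ (r * a)) 2Q≤2^a)) ⟩
    2 ^ a * r ^ (r * a) * r * (C * E)
      ≡⟨ cong (λ y → y * r * (C * E)) (trans (cong (2 ^ a *_) (sym (^-*-assoc r r a))) (sym (^-distribʳ-* a 2 (r ^ r)))) ⟩
    (2 * r ^ r) ^ a * r * (C * E)
      ≤⟨ *-monoˡ-≤ (C * E) (*-monoˡ-≤ r (^-monoˡ-≤ a (2r^r≤[r+1]^r r))) ⟩
    ((r + 1) ^ r) ^ a * r * (C * E)
      ≡⟨ cong (λ y → y * r * (C * E)) (^-*-assoc (r + 1) r a) ⟩
    (r + 1) ^ (r * a) * r * (C * E)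
      <⟨ *-monoˡ-< (C * E) {{m*n≢0 C E {{m^n≢0 (r + 1) k}} {{m^n≢0 (4 * r) (4 * k) {{m*n≢0 4 r}}}}}}
           (*-monoʳ-< ((r + 1) ^ (r * a)) {{m^n≢0 (r + 1) (r * a)}} (m<m+n r (s≤s z≤n))) ⟩
    (r + 1) ^ (r * a) * (r + 1) * (C * E)
      ≡⟨ lem₃ ((r + 1) ^ (r * a)) (r + 1) C E ⟩
    (r + 1) * (C * (r + 1) ^ (r * a)) * E
      ≡⟨ cong (λ y → (r + 1) * y * E) (^-distribˡ-+-* (r + 1) k (r * a)) ⟨
    (r + 1) * (r + 1) ^ (k + r * a) * E ∎
    where
    open ≤-Reasoning
    lem₁ : ∀ Q r A y B → Q * (r * (A * y)) * B ≡ Q * y * r * (A * B)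
    lem₁ = solve-∀
    lem₂ : ∀ Q y r X → Q * y * r * (2 * X) ≡ 2 * Q * y * r * X
    lem₂ = solve-∀
    lem₃ : ∀ y x C E → y * x * (C * E) ≡ x * (C * y) * E
    lem₃ = solve-∀

-- Quartering, the constant order, and all orders

-- Lines of a block are parts of lines of `F`, so the four coordinates can be split independently of
-- each other.
quadruple : ∀ {c} r k a .{{_ : NonZero r}} → let n = 4 * c in
  k ≤ r * r → 2 * (n * (n * n) * 4) ≤ 2 ^ a → AllEvadable c (k + r * a) → AllEvadable (4 * c) (4 * k)
quadruple {c} r k a k≤r² n≤2^a P F sp = blocks-evadable {2} P F (proj₁ s₁) (proj₁ s₂) (proj₁ s₃) (proj₁ s₄)
  (proj₂ s₁) (proj₂ s₂) (proj₂ s₃) (proj₂ s₄)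
  where
  open Sparse sp
  n = 4 * c
  split : (S : Fin n → Fin n → Fin n → Fin n → Bool) → (∀ x y z → count (S x y z) ≤ 4 * k) →
    Σ[ τ ∈ Splitting 4 c ] ∀ x y z → Fits τ (k + r * a) (S x y z)
  split = splitting₃ (xor 2) (n * (n * n)) r 1 (4 * k) (k + r * a) ≤-refl
    (quarter-small r k (n * (n * n) * 4) a k≤r² n≤2^a)
  s₁ = split (λ y z w x → F x y z w) along-x
  s₂ = split (λ x z w y → F x y z w) along-y
  s₃ = split (λ x y w z → F x y z w) along-z
  s₄ = split F along-w

-- The Chernoff condition when the mean is far below 1. With N = q D and the large tilt 1 + q, the
-- moment (1 + 1/D)^M is at most 2.
sparse-small : ∀ Q q D M u .{{_ : NonZero q}} .{{_ : NonZero D}} → 2 * M ≤ D → 2 * Q < (1 + q) ^ suc u →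
  Q * 1 ^ suc u * (q * D * 1 + q) ^ M < (1 + q) ^ suc u * (q * D * 1) ^ M
sparse-small Q q D M u 2M≤D 2Q< = begin-strict
  Q * 1 ^ suc u * (q * D * 1 + q) ^ M
    ≡⟨ cong₂ (λ x y → Q * x * y ^ M) (^-zeroˡ (suc u)) (lem₁ q D) ⟩
  Q * 1 * (q * suc D) ^ M
    ≡⟨ cong (Q * 1 *_) (^-distribʳ-* M q (suc D)) ⟩
  Q * 1 * (q ^ M * suc D ^ M)
    ≤⟨ *-monoʳ-≤ (Q * 1) (*-monoʳ-≤ (q ^ M) (1+D-power≤2 D M 2M≤D)) ⟩
  Q * 1 * (q ^ M * (2 * D ^ M))
    ≡⟨ lem₂ Q (q ^ M) (D ^ M) ⟩
  2 * Q * (q ^ M * D ^ M)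
    <⟨ *-monoˡ-< (q ^ M * D ^ M) {{m*n≢0 (q ^ M) (D ^ M) {{m^n≢0 q M}} {{m^n≢0 D M}}}} 2Q< ⟩
  (1 + q) ^ suc u * (q ^ M * D ^ M)
    ≡⟨ cong ((1 + q) ^ suc u *_) (trans (sym (^-distribʳ-* M q D)) (cong (_^ M) (sym (*-identityʳ (q * D))))) ⟩
  (1 + q) ^ suc u * (q * D * 1) ^ M ∎
  where
  open ≤-Reasoning
  lem₁ : ∀ q D → q * D * 1 + q ≡ q * (1 + D)
  lem₁ = solve-∀
  lem₂ : ∀ Q x y → Q * 1 * (x * (2 * y)) ≡ 2 * Q * (x * y)
  lem₂ = solve-∀

very-sparse : ∀ s b q D m u .{{_ : NonZero q}} .{{_ : NonZero D}} → 2 ^ s ≡ q * D →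
  let c = 2 ^ b ; n = 2 ^ s * c in
  2 * (c * (c * (c * m))) ≤ D → 2 * (n * (n * n) * 2 ^ s) < (1 + q) ^ suc u → 1 * u * u * u * u < c →
  AllEvadable (2 ^ s * 2 ^ b) m
very-sparse s b q D m u 2^s≡ M≤D Q< =
  conflict-free-shifts s {{m^n≢0 2 b}} (xor b) 1 q m u
    (subst (λ N → n * (n * n) * 2 ^ s * 1 ^ suc u * (N * 1 + q) ^ M < (1 + q) ^ suc u * (N * 1) ^ M) (sym 2^s≡)
      (sparse-small (n * (n * n) * 2 ^ s) q D M u M≤D Q<))
  where
  n = 2 ^ s * 2 ^ b
  M = 2 ^ b * (2 ^ b * (2 ^ b * m))

-- At level i a splitting into 4 blocks with r = 625 · 2^i and a = 6 i + 612 loses r a from the quarter of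
-- the bound; the second summand absorbs all these losses, and leaves 4^i.
threshold : ℕ → ℕ
threshold i = 4 ^ i + 625 * 2 ^ i * (12 * (i + 103))

base : AllEvadable (2 ^ 200) (threshold 0)
-- The union bound needs 2 · 2^600 · 2^189 = 2^790 < (1 + 2^113)^7, where 7 · 113 = 791. Also 2^113
-- · 2^76 = 2^189 and 6^4 = 1296 < 2^11.
base = very-sparse 189 11 (2 ^ 113) (2 ^ 76) (threshold 0) 6 refl
  (≤ᵇ⇒≤ _ _ tt) (≤ᵇ⇒≤ _ _ tt) (≤ᵇ⇒≤ _ _ tt)

threshold-step : ∀ i → 4 * (4 ^ i + 625 * 2 ^ i * (6 * (i + 104))) ≡ threshold (suc i)
threshold-step i = lem (4 ^ i) (2 ^ i) i
  where
  lem : ∀ x y i → 4 * (x + 625 * y * (6 * (i + 104))) ≡ 4 * x + 625 * (2 * y) * (12 * ((1 + i) + 103))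
  lem = solve-∀

threshold-split : ∀ i → threshold i ≡
  4 ^ i + 625 * 2 ^ i * (6 * (i + 104)) + 625 * 2 ^ i * (6 * i + 612)
threshold-split i = lem (4 ^ i) (2 ^ i) i
  where
  lem : ∀ x y i → x + 625 * y * (12 * (i + 103)) ≡ x + 625 * y * (6 * (i + 104)) + 625 * y * (6 * i + 612)
  lem = solve-∀

i+104≤ : ∀ i → i + 104 ≤ 104 * 2 ^ i
i+104≤ zero    = ≤-refl
i+104≤ (suc i) = begin
  1 + (i + 104)                ≤⟨ +-mono-≤ (m^n>0 2 i) (i+104≤ i) ⟩
  2 ^ i + 104 * 2 ^ i          ≤⟨ m≤m+n _ (103 * 2 ^ i) ⟩
  2 ^ i + 104 * 2 ^ i + 103 * 2 ^ i ≡⟨ lem (2 ^ i) ⟩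
  104 * (2 * 2 ^ i)            ∎
  where
  open ≤-Reasoning
  lem : ∀ x → x + 104 * x + 103 * x ≡ 104 * (2 * x)
  lem = solve-∀

stage : ∀ i → AllEvadable (2 ^ (i * 2 + 200)) (threshold i)
stage zero    = base
stage (suc i) = subst₂ AllEvadable (sym (*-assoc-2 c)) (threshold-step i)
  (quadruple {c} r k a {{m*n≢0 625 (2 ^ i) {{_}} {{m^n≢0 2 i}}}} k≤r² enough
    (subst (AllEvadable c) (threshold-split i) (stage i)))
  where
  open ≤-Reasoning
  c = 2 ^ (i * 2 + 200)
  -- 625 = 6 · 104 + 1, so k / 4^i ≤ 1 + 625 · 624 ≤ 625².
  r = 625 * 2 ^ i
  k = 4 ^ i + r * (6 * (i + 104))
  -- The union bound costs 2 · 4 · (4c)³ = 2^(6i + 609); 609 is rounded up to a multiple of 6.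
  a = 6 * i + 612
  *-assoc-2 : ∀ c → 2 * (2 * c) ≡ 4 * c
  *-assoc-2 = solve-∀
  k≤r² : k ≤ r * r
  k≤r² = begin
    4 ^ i + r * (6 * (i + 104))
      ≤⟨ +-mono-≤ (≤-reflexive (^-distribʳ-* i 2 2)) (*-monoʳ-≤ r (*-monoʳ-≤ 6 (i+104≤ i))) ⟩
    2 ^ i * 2 ^ i + r * (6 * (104 * 2 ^ i))
      ≤⟨ m≤m+n _ (624 * (2 ^ i * 2 ^ i)) ⟩
    2 ^ i * 2 ^ i + r * (6 * (104 * 2 ^ i)) + 624 * (2 ^ i * 2 ^ i)
      ≡⟨ lem (2 ^ i) ⟩
    r * r ∎
    where
    lem : ∀ x → x * x + 625 * x * (6 * (104 * x)) + 624 * (x * x) ≡ 625 * x * (625 * x)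
    lem = solve-∀
  enough : 2 * (4 * c * (4 * c * (4 * c)) * 4) ≤ 2 ^ a
  enough = begin
    2 * (4 * c * (4 * c * (4 * c)) * 4)
      ≡⟨ lem c ⟩
    2 ^ 9 * (c ^ 3)
      ≡⟨ cong (2 ^ 9 *_) (^-*-assoc 2 (i * 2 + 200) 3) ⟩
    2 ^ 9 * 2 ^ ((i * 2 + 200) * 3)
      ≡⟨ ^-distribˡ-+-* 2 9 ((i * 2 + 200) * 3) ⟨
    2 ^ (9 + (i * 2 + 200) * 3)
      ≤⟨ ^-monoʳ-≤ 2 (≤-trans (m≤m+n (9 + (i * 2 + 200) * 3) 3) (≤-reflexive (lem′ i))) ⟩
    2 ^ a ∎
    where
    lem : ∀ c → 2 * (4 * c * (4 * c * (4 * c)) * 4) ≡ 512 * (c * (c * (c * 1)))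
    lem = solve-∀
    lem′ : ∀ i → 9 + (i * 2 + 200) * 3 + 3 ≡ 6 * i + 612
    lem′ = solve-∀

unit : AllEvadable 1 0
unit F sp = proj₁ (boolean 0) , proj₂ (boolean 0) ,
  λ { zero zero zero → 𝟙≡0 (≤-trans (term≤sum (λ w → 𝟙 (F zero zero zero w)) zero) (Sparse.along-w sp zero zero zero)) }

parity : ∀ n → ∃[ i ] (n ≡ i * 2 ⊎ n ≡ 1 + i * 2)
parity zero    = 0 , inj₁ refl
parity (suc n) with parity n
... | i , inj₁ eq = i , inj₂ (cong suc eq)
... | i , inj₂ eq = suc i , inj₁ (cong suc eq)

-- The constant exceeds the base order 2^200 by a factor 2, which absorbs an odd `t`; the main term
-- 4^i of the threshold then suffices.
below-threshold : ∀ i m → m * 2 ^ 201 ≤ 2 ^ (1 + (i * 2 + 200)) → m ≤ threshold i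
below-threshold i m m≤ = ≤-trans (*-cancelʳ-≤ m (4 ^ i) (2 ^ 201) (begin
  m * 2 ^ 201              ≤⟨ m≤ ⟩
  2 ^ (1 + (i * 2 + 200))  ≡⟨ cong (2 ^_) (+-suc (i * 2) 200) ⟨
  2 ^ (i * 2 + 201)        ≡⟨ ^-distribˡ-+-* 2 (i * 2) 201 ⟩
  2 ^ (i * 2) * 2 ^ 201    ≡⟨ cong (λ j → 2 ^ j * 2 ^ 201) (*-comm i 2) ⟩
  2 ^ (2 * i) * 2 ^ 201    ≡⟨ cong (_* 2 ^ 201) (^-*-assoc 2 2 i) ⟨
  4 ^ i * 2 ^ 201          ∎)) (m≤m+n (4 ^ i) _)
  where open ≤-Reasoning

all-evadable : ∀ t m → m * 2 ^ 201 ≤ 2 ^ t → AllEvadable (2 ^ t) m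
all-evadable t m m≤ with 200 ≤? t
-- Here 2^t < 2^201 forces `m` to be 0, so nothing is forbidden.
... | no t<200 = subst₂ AllEvadable (*-identityʳ (2 ^ t)) (sym m≡0) (blow-up t unit)
  where
  m≡0 : m ≡ 0
  m≡0 = n<1⇒n≡0 (*-cancelʳ-< (2 ^ 201) m 1 (≤-<-trans m≤ (≤-trans
    (^-monoʳ-< 2 (s≤s (s≤s z≤n)) (<-trans (≰⇒> t<200) (n<1+n 200))) (≤-reflexive (sym (*-identityˡ (2 ^ 201)))))))
... | yes 200≤t with parity (t ∸ 200)
...   | i , inj₁ eq = subst (λ t → AllEvadable (2 ^ t) m) (sym t≡)
    (weaken (below-threshold i m (≤-trans m≤ (≤-trans (≤-reflexive (cong (2 ^_) t≡)) (^-monoʳ-≤ 2 (n≤1+n (i * 2 + 200)))))) (stage i))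
  where
  t≡ : t ≡ i * 2 + 200
  t≡ = trans (sym (m∸n+n≡m 200≤t)) (cong (_+ 200) eq)
...   | i , inj₂ eq = subst (λ t → AllEvadable (2 ^ t) m) (sym t≡)
    (weaken (below-threshold i m (≤-trans m≤ (≤-reflexive (cong (2 ^_) t≡)))) (blow-up 1 (stage i)))
  where
  t≡ : t ≡ 1 + (i * 2 + 200)
  t≡ = trans (sym (m∸n+n≡m 200≤t)) (cong (_+ 200) eq)

-- From relations to cubes of subsets and a rational constant

does-∈? : ∀ {n} (s : Fin n) (p : Subset n) → does (s ∈? p) ≡ lookup p s
does-∈? zero    (true  ∷ p) = refl
does-∈? zero    (false ∷ p) = refl
does-∈? (suc s) (_ ∷ p)     = does-∈? s p

occurrences-count : ∀ {n l} (s : Fin n) (f : Fin l → Subset n) →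
  occurrences s (tabulate f) ≡ count (λ j → lookup (f j) s)
occurrences-count {l = zero}  s f = refl
occurrences-count {l = suc l} s f
  with does (s ∈? f zero) | lookup (f zero) s | does-∈? s (f zero) | occurrences-count s (f ∘ suc)
... | true  | .true  | refl | ih = cong suc ih
... | false | .false | refl | ih = ih

size-count : ∀ {n} (p : Subset n) → ∣ p ∣ ≡ count (lookup p)
size-count []          = refl
size-count (true  ∷ p) = cong suc (size-count p)
size-count (false ∷ p) = size-count p

evadable⇒avoidable : ∀ {n m} → AllEvadable n m → (A : Cube (Subset n) n) → IsMCube m A → Avoidable A
evadable⇒avoidable {n} {m} P A mc =
  let (L , latin , evades) = P (λ x y z w → lookup (A x y z) w) sparse
  in L , latin , λ i j k L∈A → contradiction (trans (sym ([]=⇒lookup L∈A)) (evades i j k)) λ ()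
  where
  open IsMCube mc
  sparse : Sparse m (λ x y z w → lookup (A x y z) w)
  sparse = record
    -- The first coordinate varies along a column, the second along a row.
    { along-x = λ y z w → subst (_≤ m) (occurrences-count w (λ x → A x y z)) (column-≤ w y z)
    ; along-y = λ x z w → subst (_≤ m) (occurrences-count w (λ y → A x y z)) (row-≤ w x z)
    ; along-z = λ x y w → subst (_≤ m) (occurrences-count w (λ z → A x y z)) (file-≤ w x y)
    ; along-w = λ x y z → subst (_≤ m) (size-count (A x y z)) (cell-≤ x y z)
    }

-- Fractions in ℚ are normalised, so the inequality is carried to unnormalised rationals, whose
-- numerators and denominators are explicit.
clear-denominator : ∀ m d n → (ℤ.+ m) ℚ./ 1 ℚ.≤ (ℤ.+ 1) ℚ./ suc d ℚ.* ((ℤ.+ n) ℚ./ 1) → m * suc d ≤ n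
clear-denominator m d n h = ℤ.drop‿+≤+ (subst₂ ℤ._≤_ l≡ r≡ (ℚᵘ.drop-*≤* h′))
  where
  h′ : mkℚᵘ (ℤ.+ m) 0 ℚᵘ.≤ mkℚᵘ (ℤ.+ 1) d ℚᵘ.* mkℚᵘ (ℤ.+ n) 0
  h′ = ℚᵘ.≤-respʳ-≃
    (ℚᵘ.≃-trans (ℚ.toℚᵘ-homo-* ((ℤ.+ 1) ℚ./ suc d) ((ℤ.+ n) ℚ./ 1))
      (ℚᵘ.*-cong (ℚ.toℚᵘ-fromℚᵘ (mkℚᵘ (ℤ.+ 1) d)) (ℚ.toℚᵘ-fromℚᵘ (mkℚᵘ (ℤ.+ n) 0))))
    (ℚᵘ.≤-respˡ-≃ (ℚ.toℚᵘ-fromℚᵘ (mkℚᵘ (ℤ.+ m) 0)) (ℚ.toℚᵘ-mono-≤ h))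
  l≡ : (ℤ.+ m) ℤ.* ℚᵘ.↧ (mkℚᵘ (ℤ.+ 1) d ℚᵘ.* mkℚᵘ (ℤ.+ n) 0) ≡ ℤ.+ (m * suc d)
  l≡ = trans (sym (ℤ.pos-* m _)) (cong (λ y → ℤ.+ (m * y)) (*-identityʳ (suc d)))
  r≡ : ((ℤ.+ 1) ℤ.* (ℤ.+ n)) ℤ.* (ℤ.+ 1) ≡ ℤ.+ n
  r≡ = trans (ℤ.*-identityʳ _) (ℤ.*-identityˡ (ℤ.+ n))

theorem1 : Σ[ γ ∈ ℚ ] (0ℚ ℚ.< γ ×
    ((t : ℕ) → t ≥ 30 →
    (m : ℕ) → (ℤ.+ m) ℚ./ 1 ℚ.≤ γ ℚ.* ((ℤ.+ (2 ^ t)) ℚ./ 1) →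
    (A : Cube (Subset (2 ^ t)) (2 ^ t)) → IsMCube m A → Avoidable A))
theorem1 = γ , ℚ.positive⁻¹ γ {{ℚ.normalize-pos 1 (2 ^ 201)}} , λ t _ m m≤γn →
  -- `clear-denominator` takes the predecessor of the denominator, hence `2 ^ 201 ∸ 1`.
  evadable⇒avoidable (all-evadable t m (clear-denominator m (2 ^ 201 ∸ 1) (2 ^ t) m≤γn))
  where
  γ = (ℤ.+ 1) ℚ./ (2 ^ 201)
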